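{- The matrix $M$ is positive definite.
   Context: Fix integers $v,k$ with $k\ge2$ and $v-k\ge2$; $d=\binom v2$, with matrices indexed by the 2-element subsets of $\{1,\dots,v\}$. For $1\le j\le v$ let $C_j=\prod_{i=0}^{j-1}(k-i)/\prod_{i=0}^{j-1}(v-i)$. $N$ is the $d\times d$ matrix with $N_{\{a,b\},\{c,e\}}$ equal to $C_2-C_2^2$, $C_3-C_2^2$, or $C_4-C_2^2$ according as $|\{a,b\}\cap\{c,e\}|$ is $2$, $1$, or $0$. $M$ is the $(d-1)\times(d-1)$ principal submatrix of $N$ obtained by deleting the row and column indexed by $\{v-1,v\}$. -}

module Defs where

open import Data.Nat as ℕ using (ℕ; zero; suc; _∸_; _≡ᵇ_)
open import Data.Bool using (Bool; true; false; if_then_else_; _∨_)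
open import Data.Integer using (+_)
open import Data.Rational using (ℚ; _/_; _+_; _*_; _-_; 0ℚ; _<_)
open import Data.Fin using (Fin; zero; suc)
open import Data.List using (List; []; _∷_; map; concatMap; upTo; _++_; length; lookup)
open import Data.Product using (_×_; _,_; ∃)
open import Relation.Binary.PropositionalEquality using (_≡_; _≢_)

-- falling factorial: fall n j = n (n-1) ... (n-j+1) = ∏_{i<j} (n - i).
-- (Truncated subtraction is harmless: if j > n the factor n - n = 0 occurs.)
fall : ℕ → ℕ → ℕ
fall n zero    = 1
fall n (suc j) = fall n j ℕ.* (n ∸ j)

-- a / b as a rational; junk value 0 when b = 0 (never used: denominators are nonzero below)
frac : ℕ → ℕ → ℚ
frac a zero    = 0ℚ
frac a (suc b) = (+ a) / suc b

C : (v k j : ℕ) → ℚ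
C v k j = frac (fall k j) (fall v j)

Σ : (n : ℕ) → (Fin n → ℚ) → ℚ
Σ zero    f = 0ℚ
Σ (suc n) f = f zero + Σ n (λ i → f (suc i))

IsPositiveDefinite : (n : ℕ) → (Fin n → Fin n → ℚ) → Set
IsPositiveDefinite n A =
  (∀ i j → A i j ≡ A j i) ×
  (∀ (x : Fin n → ℚ) → ∃ (λ i → x i ≢ 0ℚ) →
     0ℚ < Σ n (λ i → Σ n (λ j → x i * A i j * x j)))

-- 2-element subsets of {1..v}, encoded 0-based as pairs (a , b) with a < b < v,
-- listed with b increasing, then a increasing.  The last one is {v-1, v} = (v-2 , v-1).
-- indexPairsM v lists all of them except {v-1, v}.
indexPairsM : ℕ → List (ℕ × ℕ)
indexPairsM v =
  concatMap (λ b → map (λ a → (a , b)) (upTo b)) (upTo (v ∸ 1))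
  ++ map (λ a → (a , v ∸ 1)) (upTo (v ∸ 2))

dimM : ℕ → ℕ
dimM v = length (indexPairsM v)

idx : (v : ℕ) → Fin (dimM v) → ℕ × ℕ
idx v i = lookup (indexPairsM v) i

b2n : Bool → ℕ
b2n true  = 1
b2n false = 0

-- |{a,b} ∩ {c,e}| for a ≠ b, c ≠ e
interSize : ℕ × ℕ → ℕ × ℕ → ℕ
interSize (a , b) (c , e) = b2n ((a ≡ᵇ c) ∨ (a ≡ᵇ e)) ℕ.+ b2n ((b ≡ᵇ c) ∨ (b ≡ᵇ e))

Nentry : (v k : ℕ) → ℕ × ℕ → ℕ × ℕ → ℚ
Nentry v k p q with interSize p q
... | 2 = C v k 2 - C v k 2 * C v k 2
... | 1 = C v k 3 - C v k 2 * C v k 2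
... | _ = C v k 4 - C v k 2 * C v k 2

-- M: principal submatrix of N with row/column {v-1, v} deleted
M : (v k : ℕ) → Fin (dimM v) → Fin (dimM v) → ℚ
M v k i j = Nentry v k (idx v i) (idx v j)

-- N is the covariance matrix of the indicators [p ⊆ K] of the pairs p inside a uniformly random
-- k-subset K of {1,…,v}: its entries are γ + ρ |p ∩ q| + θ [p = q] with γ = C₄ - C₂², ρ = C₃ - C₄
-- and θ = C₂ - 2C₃ + C₄. Hence, for x indexed by the pairs other than {v-1, v},
--   xᵀ M x = γ T² + ρ R + θ S,   T = Σₚ xₚ,  S = Σₚ xₚ²,  R = Σ_c (Σ_{p ∋ c} xₚ)².
-- Since K always contains the same number of pairs, N 𝟙 = 0, and this turns v(v-1) xᵀ M x into
--   θ (v(v-1) S - 2T²) + (v-1) ρ (v R - 4T²).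
-- The inner sums of R add up to 2T, so the second bracket is nonnegative by Cauchy–Schwarz over the
-- v points; M has only v(v-1)/2 - 1 rows, so Cauchy–Schwarz bounds the first bracket below by 2S > 0.
-- Finally (v)₄ θ = k(k-1)(v-k)(v-k-1) > 0 and (v)₄ ρ = k(k-1)(k-2)(v-k) ≥ 0 when 2 ≤ k ≤ v - 2.

module Submission where

open import Defs

open import Algebra.Bundles using (Ring)
open import Data.Bool using (Bool; true; false; T; _∨_)
open import Data.Bool.Properties using (T-∨)
open import Data.Empty using (⊥; ⊥-elim)
open import Data.Fin using (Fin; zero; suc; toℕ; fromℕ<)
open import Data.Fin.Properties using (toℕ<n; fromℕ<-toℕ; toℕ-fromℕ<; toℕ-injective)
import Data.Integer as ℤ
import Data.Integer.Properties as ℤ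
open import Data.List using (List; []; _∷_; _++_; map; concatMap; upTo; length; lookup)
import Data.List.Properties as L
open import Data.Nat as ℕ using (ℕ; zero; suc; _∸_; _≡ᵇ_; _≤_; _<_; z≤n; s≤s)
import Data.Nat.Properties as ℕ
import Data.Nat.Tactic.RingSolver as ℕ-Solver
open import Data.Product using (_×_; _,_; proj₁; proj₂)
open import Data.Rational as ℚ using (ℚ; _+_; _*_; _-_; 0ℚ; 1ℚ; positive; negative; nonNegative)
open import Data.Rational.Literals using (fromℤ)
open import Data.Rational.Properties
import Data.Rational.Unnormalised as ℚᵘ
import Data.Rational.Unnormalised.Properties as ℚᵘ
open import Data.Sum using (_⊎_; inj₁; inj₂)
open import Function.Bundles using (Equivalence; mk⇔)
open import Level using (0ℓ)
open import Relation.Binary.Definitions using (tri<; tri≈; tri>)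
open import Relation.Binary.PropositionalEquality
open import Relation.Nullary.Decidable using (yes; no; dec⇒maybe; does-⇔)
open import Tactic.RingSolver using (solve-∀)
open import Tactic.RingSolver.Core.AlmostCommutativeRing using (AlmostCommutativeRing; fromCommutativeRing)

open import Algebra.Properties.Semiring.Sum (Ring.semiring +-*-ring)
  using (sum; sum-syntax; sum-cong-≗; sum-replicate-zero; ∑-distrib-+; ∑-comm; *-distribˡ-sum; *-distribʳ-sum)

ℚ-ring : AlmostCommutativeRing 0ℓ 0ℓ
ℚ-ring = fromCommutativeRing +-*-commutativeRing (λ x → dec⇒maybe (0ℚ ≟ x))

fromℕ : ℕ → ℚ
fromℕ n = fromℤ (ℤ.+ n)

fromℕ-+ : ∀ m n → fromℕ (m ℕ.+ n) ≡ fromℕ m + fromℕ n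
fromℕ-+ m n = toℚᵘ-injective (ℚᵘ.≃-trans (ℚᵘ.*≡* numerators) (ℚᵘ.≃-sym (toℚᵘ-homo-+ (fromℕ m) (fromℕ n))))
  where
  open import Data.Integer using (+_)
  numerators : + (m ℕ.+ n) ℤ.* + 1 ≡ (+ m ℤ.* + 1 ℤ.+ + n ℤ.* + 1) ℤ.* + 1
  numerators = begin
    + (m ℕ.+ n) ℤ.* + 1                    ≡⟨ ℤ.*-identityʳ _ ⟩
    + (m ℕ.+ n)                            ≡⟨ ℤ.pos-+ m n ⟩
    + m ℤ.+ + n                            ≡⟨ sym (cong₂ ℤ._+_ (ℤ.*-identityʳ (+ m)) (ℤ.*-identityʳ (+ n))) ⟩
    + m ℤ.* + 1 ℤ.+ + n ℤ.* + 1            ≡⟨ sym (ℤ.*-identityʳ _) ⟩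
    (+ m ℤ.* + 1 ℤ.+ + n ℤ.* + 1) ℤ.* + 1  ∎
    where open ≡-Reasoning

fromℕ-* : ∀ m n → fromℕ (m ℕ.* n) ≡ fromℕ m * fromℕ n
fromℕ-* m n = toℚᵘ-injective (ℚᵘ.≃-trans (ℚᵘ.*≡* numerators) (ℚᵘ.≃-sym (toℚᵘ-homo-* (fromℕ m) (fromℕ n))))
  where
  open import Data.Integer using (+_)
  numerators : + (m ℕ.* n) ℤ.* + 1 ≡ (+ m ℤ.* + n) ℤ.* + 1
  numerators = cong (ℤ._* + 1) (ℤ.pos-* m n)

fromℕ-∸ : ∀ {m n} → n ≤ m → fromℕ (m ∸ n) ≡ fromℕ m - fromℕ n
fromℕ-∸ {m} {n} n≤m = begin
  fromℕ (m ∸ n)                      ≡⟨ add-sub (fromℕ (m ∸ n)) (fromℕ n) ⟩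
  fromℕ (m ∸ n) + fromℕ n - fromℕ n  ≡⟨ cong (_- fromℕ n) (sym (fromℕ-+ (m ∸ n) n)) ⟩
  fromℕ (m ∸ n ℕ.+ n) - fromℕ n      ≡⟨ cong (λ k → fromℕ k - fromℕ n) (ℕ.m∸n+n≡m n≤m) ⟩
  fromℕ m - fromℕ n                  ∎
  where
  open ≡-Reasoning
  add-sub : ∀ p q → p ≡ p + q - q
  add-sub = solve-∀ ℚ-ring

frac*fromℕ : ∀ a b → 0 < b → frac a b * fromℕ b ≡ fromℕ a
-- frac a (suc b) unfolds to fromℚᵘ (mkℚᵘ (+ a) b), hence the detour through ℚᵘ.
frac*fromℕ a (suc b) _ = toℚᵘ-injective (ℚᵘ.≃-trans (toℚᵘ-homo-* (frac a (suc b)) (fromℕ (suc b)))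
  (ℚᵘ.≃-trans (ℚᵘ.*-congʳ (toℚᵘ-fromℚᵘ (ℚᵘ.mkℚᵘ (+ a) b))) (ℚᵘ.*≡* numerators)))
  where
  open import Data.Integer using (+_)
  numerators : (+ a ℤ.* + suc b) ℤ.* + 1 ≡ + a ℤ.* + (suc b ℕ.* 1)
  numerators = trans (ℤ.*-identityʳ _) (cong (λ d → + a ℤ.* + d) (sym (ℕ.*-identityʳ (suc b))))

fromℕ-nonNeg : ∀ n → 0ℚ ℚ.≤ fromℕ n
fromℕ-nonNeg n = nonNegative⁻¹ (fromℕ n)

fromℕ-pos : ∀ {n} → 0 < n → 0ℚ ℚ.< fromℕ n
fromℕ-pos {suc n} _ = positive⁻¹ (fromℕ (suc n))

*-pos : ∀ {p q} → 0ℚ ℚ.< p → 0ℚ ℚ.< q → 0ℚ ℚ.< p * q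
*-pos {p} {q} p>0 q>0 = positive⁻¹ (p * q) {{pos*pos⇒pos p {{positive p>0}} q {{positive q>0}}}}

*-nonNeg : ∀ {p q} → 0ℚ ℚ.≤ p → 0ℚ ℚ.≤ q → 0ℚ ℚ.≤ p * q
*-nonNeg {p} {q} p≥0 q≥0 =
  nonNegative⁻¹ (p * q) {{nonNeg*nonNeg⇒nonNeg p {{nonNegative p≥0}} q {{nonNegative q≥0}}}}

+-pos-nonNeg : ∀ {p q} → 0ℚ ℚ.< p → 0ℚ ℚ.≤ q → 0ℚ ℚ.< p + q
+-pos-nonNeg {p} {q} p>0 q≥0 = subst (ℚ._< p + q) (+-identityʳ 0ℚ) (+-mono-<-≤ p>0 q≥0)

+-nonNeg-pos : ∀ {p q} → 0ℚ ℚ.≤ p → 0ℚ ℚ.< q → 0ℚ ℚ.< p + q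
+-nonNeg-pos {p} {q} p≥0 q>0 = subst (ℚ._< p + q) (+-identityʳ 0ℚ) (+-mono-≤-< p≥0 q>0)

+-nonNeg : ∀ {p q} → 0ℚ ℚ.≤ p → 0ℚ ℚ.≤ q → 0ℚ ℚ.≤ p + q
+-nonNeg {p} {q} p≥0 q≥0 = subst (ℚ._≤ p + q) (+-identityʳ 0ℚ) (+-mono-≤ p≥0 q≥0)

square-pos : ∀ {x} → x ≢ 0ℚ → 0ℚ ℚ.< x * x
square-pos {x} x≢0 with <-cmp x 0ℚ
... | tri< x<0 _ _ = positive⁻¹ (x * x) {{neg*neg⇒pos x {{negative x<0}} x {{negative x<0}}}}
... | tri≈ _ x≡0 _ = ⊥-elim (x≢0 x≡0)
... | tri> _ _ x>0 = *-pos x>0 x>0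

square-nonNeg : ∀ x → 0ℚ ℚ.≤ x * x
square-nonNeg x with x ≟ 0ℚ
... | yes refl = ≤-refl
... | no x≢0  = <⇒≤ (square-pos x≢0)

0<d*p⇒0<p : ∀ {d p} → 0ℚ ℚ.< d → 0ℚ ℚ.< d * p → 0ℚ ℚ.< p
0<d*p⇒0<p {d} {p} d>0 dp>0 =
  *-cancelˡ-<-nonNeg d {{nonNegative (<⇒≤ d>0)}} (subst (ℚ._< d * p) (sym (*-zeroʳ d)) dp>0)

0≤d*p⇒0≤p : ∀ {d p} → 0ℚ ℚ.< d → 0ℚ ℚ.≤ d * p → 0ℚ ℚ.≤ p
0≤d*p⇒0≤p {d} {p} d>0 dp≥0 = *-cancelˡ-≤-pos d {{positive d>0}} (subst (ℚ._≤ d * p) (sym (*-zeroʳ d)) dp≥0)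

d*p≡0⇒p≡0 : ∀ {d p} → 0ℚ ℚ.< d → d * p ≡ 0ℚ → p ≡ 0ℚ
d*p≡0⇒p≡0 {d} {p} d>0 dp≡0 = ≤-antisym (*-cancelˡ-≤-pos d {{positive d>0}} (≤-reflexive d*p≡d*0))
                                        (*-cancelˡ-≤-pos d {{positive d>0}} (≤-reflexive (sym d*p≡d*0)))
  where
  d*p≡d*0 : d * p ≡ d * 0ℚ
  d*p≡d*0 = trans dp≡0 (sym (*-zeroʳ d))

𝟙 : Bool → ℚ
𝟙 b = fromℕ (b2n b)

Σ≡sum : ∀ n (f : Fin n → ℚ) → Σ n f ≡ sum f
Σ≡sum zero    f = refl
Σ≡sum (suc n) f = cong (f zero +_) (Σ≡sum n (λ i → f (suc i)))

sum-const : ∀ n c → ∑[ i < n ] c ≡ fromℕ n * c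
sum-const zero    c = sym (*-zeroˡ c)
sum-const (suc n) c = begin
  c + ∑[ i < n ] c       ≡⟨ cong (c +_) (sum-const n c) ⟩
  c + fromℕ n * c        ≡⟨ distrib c (fromℕ n) ⟩
  (1ℚ + fromℕ n) * c     ≡⟨ cong (_* c) (sym (fromℕ-+ 1 n)) ⟩
  fromℕ (suc n) * c      ∎
  where
  open ≡-Reasoning
  distrib : ∀ c N → c + N * c ≡ (1ℚ + N) * c
  distrib = solve-∀ ℚ-ring

sum-zero : ∀ n (f : Fin n → ℚ) → ∑[ j < n ] (0ℚ * f j) ≡ 0ℚ
sum-zero n f = trans (sum-cong-≗ (λ j → *-zeroˡ (f j))) (sum-replicate-zero n)

sum-𝟙-≡ᵇ : ∀ {n} (f : Fin n → ℚ) {a} (a<n : a < n) →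
           ∑[ j < n ] (𝟙 (toℕ j ≡ᵇ a) * f j) ≡ f (fromℕ< a<n)
sum-𝟙-≡ᵇ {suc n} f {zero} _ = begin
  1ℚ * f zero + ∑[ j < n ] (0ℚ * f (suc j))  ≡⟨ cong₂ _+_ (*-identityˡ (f zero)) (sum-zero n (λ j → f (suc j))) ⟩
  f zero + 0ℚ                                ≡⟨ +-identityʳ (f zero) ⟩
  f zero                                     ∎
  where open ≡-Reasoning
sum-𝟙-≡ᵇ {suc n} f {suc a} (s≤s a<n) = begin
  0ℚ * f zero + ∑[ j < n ] (𝟙 (toℕ j ≡ᵇ a) * f (suc j))  ≡⟨ cong₂ _+_ (*-zeroˡ (f zero)) (sum-𝟙-≡ᵇ (λ j → f (suc j)) a<n) ⟩
  0ℚ + f (suc (fromℕ< a<n))                              ≡⟨ +-identityˡ _ ⟩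
  f (suc (fromℕ< a<n))                                   ∎
  where open ≡-Reasoning

sum-squares : ∀ {n} → (Fin n → ℚ) → ℚ
sum-squares {n} f = ∑[ i < n ] (f i * f i)

sum-squares-nonNeg : ∀ {n} (f : Fin n → ℚ) → 0ℚ ℚ.≤ sum-squares f
sum-squares-nonNeg {zero}  f = ≤-refl
sum-squares-nonNeg {suc n} f = +-nonNeg (square-nonNeg (f zero)) (sum-squares-nonNeg (λ i → f (suc i)))

sum-squares-pos : ∀ {n} (f : Fin n → ℚ) i → f i ≢ 0ℚ → 0ℚ ℚ.< sum-squares f
sum-squares-pos f zero    fi≢0 = +-pos-nonNeg (square-pos fi≢0) (sum-squares-nonNeg (λ i → f (suc i)))
sum-squares-pos f (suc i) fi≢0 = +-nonNeg-pos (square-nonNeg (f zero)) (sum-squares-pos (λ i → f (suc i)) i fi≢0)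

sum-squares-shift : ∀ {n} a (f : Fin n → ℚ) →
  sum-squares (λ i → a - f i) + fromℕ 2 * a * sum f ≡ fromℕ n * (a * a) + sum-squares f
sum-squares-shift {n} a f = begin
  sum-squares (λ i → a - f i) + fromℕ 2 * a * sum f
    ≡⟨ cong (sum-squares (λ i → a - f i) +_) (*-distribˡ-sum (fromℕ 2 * a) f) ⟩
  sum-squares (λ i → a - f i) + ∑[ i < n ] (fromℕ 2 * a * f i)
    ≡⟨ sym (∑-distrib-+ (λ i → (a - f i) * (a - f i)) (λ i → fromℕ 2 * a * f i)) ⟩
  ∑[ i < n ] ((a - f i) * (a - f i) + fromℕ 2 * a * f i)
    ≡⟨ sum-cong-≗ (λ i → expand a (f i)) ⟩
  ∑[ i < n ] (a * a + f i * f i)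
    ≡⟨ ∑-distrib-+ (λ _ → a * a) (λ i → f i * f i) ⟩
  ∑[ i < n ] (a * a) + sum-squares f
    ≡⟨ cong (_+ sum-squares f) (sum-const n (a * a)) ⟩
  fromℕ n * (a * a) + sum-squares f
    ∎
  where
  open ≡-Reasoning
  expand : ∀ a x → (a - x) * (a - x) + fromℕ 2 * a * x ≡ a * a + x * x
  expand = solve-∀ ℚ-ring

cauchy-schwarz : ∀ {n} (f : Fin n → ℚ) → 0ℚ ℚ.≤ fromℕ n * sum-squares f - sum f * sum f
cauchy-schwarz {zero}  f = ≤-refl
cauchy-schwarz {suc n} f = subst (0ℚ ℚ.≤_) (sym step) (+-nonNeg (cauchy-schwarz g) (sum-squares-nonNeg (λ i → a - g i)))
  where
  a N t s X : ℚ
  g : Fin n → ℚ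
  a = f zero
  g i = f (suc i)
  N = fromℕ n
  t = sum g
  s = sum-squares g
  X = sum-squares (λ i → a - g i)
  open ≡-Reasoning
  rearrange : ∀ N a t s → (1ℚ + N) * (a * a + s) - (a + t) * (a + t)
                        ≡ (N * s - t * t) + ((N * (a * a) + s) - fromℕ 2 * a * t)
  rearrange = solve-∀ ℚ-ring
  cancel : ∀ D X Y → D + ((X + Y) - Y) ≡ D + X
  cancel = solve-∀ ℚ-ring
  step : fromℕ (suc n) * (a * a + s) - (a + t) * (a + t) ≡ (N * s - t * t) + X
  step = begin
    fromℕ (suc n) * (a * a + s) - (a + t) * (a + t)
      ≡⟨ cong (λ M → M * (a * a + s) - (a + t) * (a + t)) (fromℕ-+ 1 n) ⟩
    (1ℚ + N) * (a * a + s) - (a + t) * (a + t)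
      ≡⟨ rearrange N a t s ⟩
    (N * s - t * t) + ((N * (a * a) + s) - fromℕ 2 * a * t)
      ≡⟨ cong (λ Y → (N * s - t * t) + (Y - fromℕ 2 * a * t)) (sym (sum-squares-shift a g)) ⟩
    (N * s - t * t) + ((X + fromℕ 2 * a * t) - fromℕ 2 * a * t)
      ≡⟨ cancel (N * s - t * t) X (fromℕ 2 * a * t) ⟩
    (N * s - t * t) + X
      ∎

≡ᵇ-sym : ∀ m n → (m ≡ᵇ n) ≡ (n ≡ᵇ m)
≡ᵇ-sym m n = does-⇔ (mk⇔ sym sym) (m ℕ.≟ n) (n ℕ.≟ m)

δ : ∀ {n} → Fin n → Fin n → ℚ
δ i j = 𝟙 (toℕ i ≡ᵇ toℕ j)

δ-sym : ∀ {n} (i j : Fin n) → δ i j ≡ δ j i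
δ-sym i j = cong 𝟙 (≡ᵇ-sym (toℕ i) (toℕ j))

-- Quadratic forms

quadForm : ∀ {n} → (Fin n → Fin n → ℚ) → (Fin n → ℚ) → ℚ
quadForm {n} A x = ∑[ i < n ] ∑[ j < n ] (x i * A i j * x j)

module _ {n : ℕ} (x : Fin n → ℚ) where

  Σ≡quadForm : ∀ A → Σ n (λ i → Σ n (λ j → x i * A i j * x j)) ≡ quadForm A x
  Σ≡quadForm A = trans (Σ≡sum n _) (sum-cong-≗ (λ i → Σ≡sum n (λ j → x i * A i j * x j)))

  quadForm-cong : ∀ {A B : Fin n → Fin n → ℚ} → (∀ i j → A i j ≡ B i j) → quadForm A x ≡ quadForm B x
  quadForm-cong A≡B = sum-cong-≗ (λ i → sum-cong-≗ (λ j → cong (λ a → x i * a * x j) (A≡B i j)))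

  quadForm-+ : ∀ (A B : Fin n → Fin n → ℚ) → quadForm (λ i j → A i j + B i j) x ≡ quadForm A x + quadForm B x
  quadForm-+ A B = begin
    ∑[ i < n ] ∑[ j < n ] (x i * (A i j + B i j) * x j)
      ≡⟨ sum-cong-≗ (λ i → sum-cong-≗ (λ j → distrib (x i) (A i j) (B i j) (x j))) ⟩
    ∑[ i < n ] ∑[ j < n ] (x i * A i j * x j + x i * B i j * x j)
      ≡⟨ sum-cong-≗ (λ i → ∑-distrib-+ (λ j → x i * A i j * x j) (λ j → x i * B i j * x j)) ⟩
    ∑[ i < n ] (∑[ j < n ] (x i * A i j * x j) + ∑[ j < n ] (x i * B i j * x j))
      ≡⟨ ∑-distrib-+ (λ i → ∑[ j < n ] (x i * A i j * x j)) (λ i → ∑[ j < n ] (x i * B i j * x j)) ⟩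
    quadForm A x + quadForm B x
      ∎
    where
    open ≡-Reasoning
    distrib : ∀ a p q b → a * (p + q) * b ≡ a * p * b + a * q * b
    distrib = solve-∀ ℚ-ring

  quadForm-* : ∀ c (A : Fin n → Fin n → ℚ) → quadForm (λ i j → c * A i j) x ≡ c * quadForm A x
  quadForm-* c A = begin
    ∑[ i < n ] ∑[ j < n ] (x i * (c * A i j) * x j)
      ≡⟨ sum-cong-≗ (λ i → sum-cong-≗ (λ j → pull (x i) c (A i j) (x j))) ⟩
    ∑[ i < n ] ∑[ j < n ] (c * (x i * A i j * x j))
      ≡⟨ sum-cong-≗ (λ i → sym (*-distribˡ-sum c (λ j → x i * A i j * x j))) ⟩
    ∑[ i < n ] (c * ∑[ j < n ] (x i * A i j * x j))
      ≡⟨ sym (*-distribˡ-sum c (λ i → ∑[ j < n ] (x i * A i j * x j))) ⟩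
    c * quadForm A x
      ∎
    where
    open ≡-Reasoning
    pull : ∀ a c p b → a * (c * p) * b ≡ c * (a * p * b)
    pull = solve-∀ ℚ-ring

  quadForm-outer : ∀ (u : Fin n → ℚ) →
    quadForm (λ i j → u i * u j) x ≡ ∑[ i < n ] (u i * x i) * ∑[ i < n ] (u i * x i)
  quadForm-outer u = begin
    ∑[ i < n ] ∑[ j < n ] (x i * (u i * u j) * x j)
      ≡⟨ sum-cong-≗ (λ i → sum-cong-≗ (λ j → split (x i) (u i) (u j) (x j))) ⟩
    ∑[ i < n ] ∑[ j < n ] (u i * x i * (u j * x j))
      ≡⟨ sum-cong-≗ (λ i → sym (*-distribˡ-sum (u i * x i) (λ j → u j * x j))) ⟩
    ∑[ i < n ] (u i * x i * ∑[ j < n ] (u j * x j))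
      ≡⟨ sym (*-distribʳ-sum (∑[ j < n ] (u j * x j)) (λ i → u i * x i)) ⟩
    ∑[ i < n ] (u i * x i) * ∑[ i < n ] (u i * x i)
      ∎
    where
    open ≡-Reasoning
    split : ∀ a p q b → a * (p * q) * b ≡ p * a * (q * b)
    split = solve-∀ ℚ-ring

  quadForm-∑ : ∀ m (A : Fin m → Fin n → Fin n → ℚ) →
    quadForm (λ i j → ∑[ c < m ] A c i j) x ≡ ∑[ c < m ] quadForm (A c) x
  quadForm-∑ m A = begin
    ∑[ i < n ] ∑[ j < n ] (x i * ∑[ c < m ] A c i j * x j)
      ≡⟨ sum-cong-≗ (λ i → sum-cong-≗ (λ j → inside i j)) ⟩
    ∑[ i < n ] ∑[ j < n ] ∑[ c < m ] (x i * A c i j * x j)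
      ≡⟨ sum-cong-≗ (λ i → ∑-comm (λ j c → x i * A c i j * x j)) ⟩
    ∑[ i < n ] ∑[ c < m ] ∑[ j < n ] (x i * A c i j * x j)
      ≡⟨ ∑-comm (λ i c → ∑[ j < n ] (x i * A c i j * x j)) ⟩
    ∑[ c < m ] quadForm (A c) x
      ∎
    where
    open ≡-Reasoning
    inside : ∀ i j → x i * ∑[ c < m ] A c i j * x j ≡ ∑[ c < m ] (x i * A c i j * x j)
    inside i j = trans (cong (_* x j) (*-distribˡ-sum (x i) (λ c → A c i j)))
                       (*-distribʳ-sum (x j) (λ c → x i * A c i j))

  quadForm-const : ∀ c → quadForm (λ _ _ → c) x ≡ c * (sum x * sum x)
  quadForm-const c = begin
    quadForm (λ _ _ → c) x                                ≡⟨ quadForm-cong (λ _ _ → sym (*-identityʳ c)) ⟩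
    quadForm (λ _ _ → c * (1ℚ * 1ℚ)) x                    ≡⟨ quadForm-* c (λ _ _ → 1ℚ * 1ℚ) ⟩
    c * quadForm (λ _ _ → 1ℚ * 1ℚ) x                      ≡⟨ cong (c *_) (quadForm-outer (λ _ → 1ℚ)) ⟩
    c * (∑[ i < n ] (1ℚ * x i) * ∑[ i < n ] (1ℚ * x i))  ≡⟨ cong (λ s → c * (s * s)) (sum-cong-≗ (λ i → *-identityˡ (x i))) ⟩
    c * (sum x * sum x)                                   ∎
    where open ≡-Reasoning

  quadForm-gram : ∀ {m} (u : Fin m → Fin n → ℚ) →
    quadForm (λ i j → ∑[ c < m ] (u c i * u c j)) x ≡ sum-squares (λ c → ∑[ i < n ] (u c i * x i))
  quadForm-gram {m} u = trans (quadForm-∑ m (λ c i j → u c i * u c j)) (sum-cong-≗ (λ c → quadForm-outer (u c)))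

  quadForm-δ : quadForm δ x ≡ sum-squares x
  quadForm-δ = sum-cong-≗ row
    where
    open ≡-Reasoning
    rearrange : ∀ a d b → a * d * b ≡ d * (a * b)
    rearrange = solve-∀ ℚ-ring
    row : ∀ i → ∑[ j < n ] (x i * δ i j * x j) ≡ x i * x i
    row i = begin
      ∑[ j < n ] (x i * δ i j * x j)    ≡⟨ sum-cong-≗ (λ j → trans (rearrange (x i) (δ i j) (x j))
                                                                (cong (_* (x i * x j)) (δ-sym i j))) ⟩
      ∑[ j < n ] (δ j i * (x i * x j))  ≡⟨ sum-𝟙-≡ᵇ (λ j → x i * x j) (toℕ<n i) ⟩
      x i * x (fromℕ< (toℕ<n i))        ≡⟨ cong (λ j → x i * x j) (fromℕ<-toℕ i (toℕ<n i)) ⟩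
      x i * x i                         ∎

-- The entries of N

fall-zero : ∀ {n j} → n < j → fall n j ≡ 0
fall-zero {n} {suc j} (s≤s n≤j) with ℕ.m≤n⇒m<n∨m≡n n≤j
... | inj₁ n<j  = cong (ℕ._* (n ∸ j)) (fall-zero n<j)
... | inj₂ refl = trans (cong (fall n n ℕ.*_) (ℕ.n∸n≡0 n)) (ℕ.*-zeroʳ (fall n n))

fall-nonZero : ∀ {n j} → j ≤ n → ℕ.NonZero (fall n j)
fall-nonZero {n} {zero}  _   = _
fall-nonZero {n} {suc j} j<n =
  ℕ.m*n≢0 (fall n j) (n ∸ j) {{fall-nonZero (ℕ.<⇒≤ j<n)}} {{ℕ.>-nonZero (ℕ.m<n⇒0<n∸m j<n)}}

fallℚ : ℚ → ℕ → ℚ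
fallℚ x zero    = 1ℚ
fallℚ x (suc j) = fallℚ x j * (x - fromℕ j)

fromℕ-fall : ∀ n j → fromℕ (fall n j) ≡ fallℚ (fromℕ n) j
fromℕ-fall n zero    = refl
fromℕ-fall n (suc j) with j ℕ.≤? n
... | yes j≤n = trans (fromℕ-* (fall n j) (n ∸ j)) (cong₂ _*_ (fromℕ-fall n j) (fromℕ-∸ j≤n))
-- For j > n the truncated factor n ∸ j is not fromℕ n - fromℕ j, but both products already vanish.
... | no  j≰n = begin
  fromℕ (fall n j ℕ.* (n ∸ j))            ≡⟨ cong (λ m → fromℕ (m ℕ.* (n ∸ j))) fall≡0 ⟩
  0ℚ                                      ≡⟨ sym (*-zeroˡ (fromℕ n - fromℕ j)) ⟩
  0ℚ * (fromℕ n - fromℕ j)                ≡⟨ cong (λ z → fromℕ z * (fromℕ n - fromℕ j)) (sym fall≡0) ⟩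
  fromℕ (fall n j) * (fromℕ n - fromℕ j)  ≡⟨ cong (_* (fromℕ n - fromℕ j)) (fromℕ-fall n j) ⟩
  fallℚ (fromℕ n) j * (fromℕ n - fromℕ j) ∎
  where
  open ≡-Reasoning
  fall≡0 : fall n j ≡ 0
  fall≡0 = fall-zero (ℕ.≰⇒> j≰n)

C*fallℚ : ∀ {v} k {j} → j ≤ v → C v k j * fallℚ (fromℕ v) j ≡ fallℚ (fromℕ k) j
C*fallℚ {v} k {j} j≤v = begin
  C v k j * fallℚ (fromℕ v) j                    ≡⟨ cong (C v k j *_) (sym (fromℕ-fall v j)) ⟩
  frac (fall k j) (fall v j) * fromℕ (fall v j)  ≡⟨ frac*fromℕ (fall k j) (fall v j) (ℕ.>-nonZero⁻¹ (fall v j) {{fall-nonZero j≤v}}) ⟩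
  fromℕ (fall k j)                               ≡⟨ fromℕ-fall k j ⟩
  fallℚ (fromℕ k) j                              ∎
  where open ≡-Reasoning

cong₃ : ∀ {A B C D : Set} (f : A → B → C → D) {a a′ b b′ c c′} →
        a ≡ a′ → b ≡ b′ → c ≡ c′ → f a b c ≡ f a′ b′ c′
cong₃ f refl refl refl = refl

b2n≤1 : ∀ b → b2n b ≤ 1
b2n≤1 true  = s≤s z≤n
b2n≤1 false = z≤n

interSize≤2 : ∀ p q → interSize p q ≤ 2
interSize≤2 (a , b) (c , e) = ℕ.+-mono-≤ (b2n≤1 ((a ≡ᵇ c) ∨ (a ≡ᵇ e))) (b2n≤1 ((b ≡ᵇ c) ∨ (b ≡ᵇ e)))

module Coefficients (v k : ℕ) where

  -- θ and θ + (v - 2) ρ are the two nonzero eigenvalues of N.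
  c₂ c₃ c₄ γ ρ θ : ℚ
  c₂ = C v k 2
  c₃ = C v k 3
  c₄ = C v k 4
  γ = c₄ - c₂ * c₂
  ρ = c₃ - c₄
  θ = c₂ - fromℕ 2 * c₃ + c₄

  Nentry-shape : ∀ p q → Nentry v k p q ≡ γ + ρ * fromℕ (interSize p q) + θ * 𝟙 (interSize p q ≡ᵇ 2)
  Nentry-shape p q with interSize p q | interSize≤2 p q
  ... | 0 | _ = shape₀ c₂ c₃ c₄
    where
    shape₀ : ∀ c₂ c₃ c₄ → c₄ - c₂ * c₂ ≡ (c₄ - c₂ * c₂) + (c₃ - c₄) * fromℕ 0 + (c₂ - fromℕ 2 * c₃ + c₄) * 𝟙 false
    shape₀ = solve-∀ ℚ-ring
  ... | 1 | _ = shape₁ c₂ c₃ c₄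
    where
    shape₁ : ∀ c₂ c₃ c₄ → c₃ - c₂ * c₂ ≡ (c₄ - c₂ * c₂) + (c₃ - c₄) * fromℕ 1 + (c₂ - fromℕ 2 * c₃ + c₄) * 𝟙 false
    shape₁ = solve-∀ ℚ-ring
  ... | 2 | _ = shape₂ c₂ c₃ c₄
    where
    shape₂ : ∀ c₂ c₃ c₄ → c₂ - c₂ * c₂ ≡ (c₄ - c₂ * c₂) + (c₃ - c₄) * fromℕ 2 + (c₂ - fromℕ 2 * c₃ + c₄) * 𝟙 true
    shape₂ = solve-∀ ℚ-ring
  ... | suc (suc (suc _)) | s≤s (s≤s ())

  module _ (2≤k : 2 ≤ k) (2≤v∸k : 2 ≤ v ∸ k) where

    private
      V K D : ℚ
      V = fromℕ v
      K = fromℕ k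
      D = fallℚ V 4

      k≤v : k ≤ v
      k≤v = ℕ.<⇒≤ (ℕ.m∸n≢0⇒n<m (ℕ.m<n⇒n≢0 2≤v∸k))

      4≤v : 4 ≤ v
      4≤v = subst (4 ≤_) (ℕ.m∸n+n≡m k≤v) (ℕ.+-mono-≤ 2≤v∸k 2≤k)

      D>0 : 0ℚ ℚ.< D
      D>0 = subst (0ℚ ℚ.<_) (fromℕ-fall v 4) (fromℕ-pos (ℕ.>-nonZero⁻¹ (fall v 4) {{fall-nonZero 4≤v}}))

      spec₂ : c₂ * fallℚ V 2 ≡ fallℚ K 2
      spec₂ = C*fallℚ k (ℕ.≤-trans (s≤s (s≤s z≤n)) 4≤v)
      spec₃ : c₃ * fallℚ V 3 ≡ fallℚ K 3
      spec₃ = C*fallℚ k (ℕ.≤-trans (s≤s (s≤s (s≤s z≤n))) 4≤v)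
      spec₄ : c₄ * fallℚ V 4 ≡ fallℚ K 4
      spec₄ = C*fallℚ k 4≤v

      K-1≡ : K - fromℕ 1 ≡ fromℕ (k ∸ 1)
      K-1≡ = sym (fromℕ-∸ (ℕ.<⇒≤ 2≤k))
      K-2≡ : K - fromℕ 2 ≡ fromℕ (k ∸ 2)
      K-2≡ = sym (fromℕ-∸ 2≤k)
      V-K≡ : V - K ≡ fromℕ (v ∸ k)
      V-K≡ = sym (fromℕ-∸ k≤v)
      V-K-1≡ : V - K - fromℕ 1 ≡ fromℕ (v ∸ k ∸ 1)
      V-K-1≡ = trans (cong (_- fromℕ 1) V-K≡) (sym (fromℕ-∸ (ℕ.<⇒≤ 2≤v∸k)))

    D*θ : D * θ ≡ fromℕ k * fromℕ (k ∸ 1) * (fromℕ (v ∸ k) * fromℕ (v ∸ k ∸ 1))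
    D*θ = begin
      D * θ
        ≡⟨ expand V c₂ c₃ c₄ ⟩
      c₂ * fallℚ V 2 * X₂ - fromℕ 2 * (c₃ * fallℚ V 3 * X₃) + c₄ * fallℚ V 4
        ≡⟨ cong₃ (λ a b c → a * X₂ - fromℕ 2 * (b * X₃) + c) spec₂ spec₃ spec₄ ⟩
      fallℚ K 2 * X₂ - fromℕ 2 * (fallℚ K 3 * X₃) + fallℚ K 4
        ≡⟨ factor V K ⟩
      K * (K - fromℕ 1) * ((V - K) * (V - K - fromℕ 1))
        ≡⟨ cong₂ (λ a b → K * a * b) K-1≡ (cong₂ _*_ V-K≡ V-K-1≡) ⟩
      fromℕ k * fromℕ (k ∸ 1) * (fromℕ (v ∸ k) * fromℕ (v ∸ k ∸ 1))
        ∎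
      where
      open ≡-Reasoning
      X₂ X₃ : ℚ
      X₂ = (V - fromℕ 2) * (V - fromℕ 3)
      X₃ = V - fromℕ 3
      -- The ring solver treats fallℚ V j as an opaque constant, so the products are spelled out here.
      expand : ∀ V c₂ c₃ c₄ →
        let f₂ = 1ℚ * (V - fromℕ 0) * (V - fromℕ 1) ; f₃ = f₂ * (V - fromℕ 2) ; f₄ = f₃ * (V - fromℕ 3) in
        f₄ * (c₂ - fromℕ 2 * c₃ + c₄)
          ≡ c₂ * f₂ * ((V - fromℕ 2) * (V - fromℕ 3)) - fromℕ 2 * (c₃ * f₃ * (V - fromℕ 3)) + c₄ * f₄
      expand = solve-∀ ℚ-ring
      factor : ∀ V K →
        let f₂ = 1ℚ * (K - fromℕ 0) * (K - fromℕ 1) ; f₃ = f₂ * (K - fromℕ 2) ; f₄ = f₃ * (K - fromℕ 3) in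
        f₂ * ((V - fromℕ 2) * (V - fromℕ 3)) - fromℕ 2 * (f₃ * (V - fromℕ 3)) + f₄
          ≡ K * (K - fromℕ 1) * ((V - K) * (V - K - fromℕ 1))
      factor = solve-∀ ℚ-ring

    θ>0 : 0ℚ ℚ.< θ
    θ>0 = 0<d*p⇒0<p D>0 (subst (0ℚ ℚ.<_) (sym D*θ)
      (*-pos (*-pos (fromℕ-pos k>0) (fromℕ-pos k∸1>0)) (*-pos (fromℕ-pos v∸k>0) (fromℕ-pos v∸k∸1>0))))
      where
      k>0 : 0 < k
      k>0 = ℕ.<-trans (s≤s z≤n) 2≤k
      k∸1>0 : 0 < k ∸ 1
      k∸1>0 = ℕ.m<n⇒0<n∸m 2≤k
      v∸k>0 : 0 < v ∸ k
      v∸k>0 = ℕ.<-trans (s≤s z≤n) 2≤v∸k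
      v∸k∸1>0 : 0 < v ∸ k ∸ 1
      v∸k∸1>0 = ℕ.m<n⇒0<n∸m 2≤v∸k

    D*ρ : D * ρ ≡ fromℕ k * fromℕ (k ∸ 1) * (fromℕ (k ∸ 2) * fromℕ (v ∸ k))
    D*ρ = begin
      D * ρ                                             ≡⟨ expand V c₃ c₄ ⟩
      c₃ * fallℚ V 3 * (V - fromℕ 3) - c₄ * fallℚ V 4   ≡⟨ cong₂ (λ b c → b * (V - fromℕ 3) - c) spec₃ spec₄ ⟩
      fallℚ K 3 * (V - fromℕ 3) - fallℚ K 4             ≡⟨ factor V K ⟩
      K * (K - fromℕ 1) * ((K - fromℕ 2) * (V - K))     ≡⟨ cong₂ (λ a b → K * a * b) K-1≡ (cong₂ _*_ K-2≡ V-K≡) ⟩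
      fromℕ k * fromℕ (k ∸ 1) * (fromℕ (k ∸ 2) * fromℕ (v ∸ k)) ∎
      where
      open ≡-Reasoning
      expand : ∀ V c₃ c₄ →
        let f₃ = 1ℚ * (V - fromℕ 0) * (V - fromℕ 1) * (V - fromℕ 2) ; f₄ = f₃ * (V - fromℕ 3) in
        f₄ * (c₃ - c₄) ≡ c₃ * f₃ * (V - fromℕ 3) - c₄ * f₄
      expand = solve-∀ ℚ-ring
      factor : ∀ V K →
        let f₃ = 1ℚ * (K - fromℕ 0) * (K - fromℕ 1) * (K - fromℕ 2) ; f₄ = f₃ * (K - fromℕ 3) in
        f₃ * (V - fromℕ 3) - f₄ ≡ K * (K - fromℕ 1) * ((K - fromℕ 2) * (V - K))
      factor = solve-∀ ℚ-ring

    ρ≥0 : 0ℚ ℚ.≤ ρ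
    ρ≥0 = 0≤d*p⇒0≤p D>0 (subst (0ℚ ℚ.≤_) (sym D*ρ)
      (*-nonNeg (*-nonNeg (fromℕ-nonNeg k) (fromℕ-nonNeg (k ∸ 1))) (*-nonNeg (fromℕ-nonNeg (k ∸ 2)) (fromℕ-nonNeg (v ∸ k)))))

    -- This is N 𝟙 = 0.
    rowSum≡0 : V * (V - 1ℚ) * γ + fromℕ 2 * θ + fromℕ 4 * (V - 1ℚ) * ρ ≡ 0ℚ
    rowSum≡0 = d*p≡0⇒p≡0 D>0 (begin
      D * (V * (V - 1ℚ) * γ + fromℕ 2 * θ + fromℕ 4 * (V - 1ℚ) * ρ)
        ≡⟨ expand V c₂ c₃ c₄ ⟩
      R (c₂ * fallℚ V 2) (c₃ * fallℚ V 3) (c₄ * fallℚ V 4)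
        ≡⟨ cong₃ R spec₂ spec₃ spec₄ ⟩
      R (fallℚ K 2) (fallℚ K 3) (fallℚ K 4)
        ≡⟨ vanish V K ⟩
      0ℚ ∎)
      where
      open ≡-Reasoning
      X₂ X₃ : ℚ
      X₂ = (V - fromℕ 2) * (V - fromℕ 3)
      X₃ = V - fromℕ 3
      R : ℚ → ℚ → ℚ → ℚ
      R a b c = V * (V - 1ℚ) * c - a * a * X₂ + fromℕ 2 * (a * X₂ - fromℕ 2 * (b * X₃) + c)
                + fromℕ 4 * (V - 1ℚ) * (b * X₃ - c)
      expand : ∀ V c₂ c₃ c₄ →
        let f₂ = 1ℚ * (V - fromℕ 0) * (V - fromℕ 1) ; f₃ = f₂ * (V - fromℕ 2) ; f₄ = f₃ * (V - fromℕ 3)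
            X₂ = (V - fromℕ 2) * (V - fromℕ 3) ; X₃ = V - fromℕ 3 in
        f₄ * (V * (V - 1ℚ) * (c₄ - c₂ * c₂) + fromℕ 2 * (c₂ - fromℕ 2 * c₃ + c₄) + fromℕ 4 * (V - 1ℚ) * (c₃ - c₄))
          ≡ V * (V - 1ℚ) * (c₄ * f₄) - (c₂ * f₂) * (c₂ * f₂) * X₂
            + fromℕ 2 * ((c₂ * f₂) * X₂ - fromℕ 2 * ((c₃ * f₃) * X₃) + c₄ * f₄)
            + fromℕ 4 * (V - 1ℚ) * ((c₃ * f₃) * X₃ - c₄ * f₄)
      expand = solve-∀ ℚ-ring
      vanish : ∀ V K →
        let f₂ = 1ℚ * (K - fromℕ 0) * (K - fromℕ 1) ; f₃ = f₂ * (K - fromℕ 2) ; f₄ = f₃ * (K - fromℕ 3)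
            X₂ = (V - fromℕ 2) * (V - fromℕ 3) ; X₃ = V - fromℕ 3 in
        V * (V - 1ℚ) * f₄ - f₂ * f₂ * X₂ + fromℕ 2 * (f₂ * X₂ - fromℕ 2 * (f₃ * X₃) + f₄)
          + fromℕ 4 * (V - 1ℚ) * (f₃ * X₃ - f₄) ≡ 0ℚ
      vanish = solve-∀ ℚ-ring

_∈ᵖ_ : ℕ → ℕ × ℕ → Bool
c ∈ᵖ (a , b) = (c ≡ᵇ a) ∨ (c ≡ᵇ b)

IsPair : ℕ → ℕ × ℕ → Set
IsPair v (a , b) = a < b × b < v

𝟙-∨ : ∀ x y → (T x → T y → ⊥) → 𝟙 (x ∨ y) ≡ 𝟙 x + 𝟙 y
𝟙-∨ true  true  not-both = ⊥-elim (not-both _ _)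
𝟙-∨ true  false _        = refl
𝟙-∨ false true  _        = refl
𝟙-∨ false false _        = refl

sum-𝟙-∈ᵖ : ∀ {v a b} (g : Fin v → ℚ) → a ≢ b → (a<v : a < v) (b<v : b < v) →
           ∑[ c < v ] (𝟙 (toℕ c ∈ᵖ (a , b)) * g c) ≡ g (fromℕ< a<v) + g (fromℕ< b<v)
sum-𝟙-∈ᵖ {v} {a} {b} g a≢b a<v b<v = begin
  ∑[ c < v ] (𝟙 (toℕ c ∈ᵖ (a , b)) * g c)
    ≡⟨ sum-cong-≗ (λ c → trans (cong (_* g c) (𝟙-∨ (toℕ c ≡ᵇ a) (toℕ c ≡ᵇ b) (not-both (toℕ c))))
                               (*-distribʳ-+ (g c) (𝟙 (toℕ c ≡ᵇ a)) (𝟙 (toℕ c ≡ᵇ b)))) ⟩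
  ∑[ c < v ] (𝟙 (toℕ c ≡ᵇ a) * g c + 𝟙 (toℕ c ≡ᵇ b) * g c)
    ≡⟨ ∑-distrib-+ (λ c → 𝟙 (toℕ c ≡ᵇ a) * g c) (λ c → 𝟙 (toℕ c ≡ᵇ b) * g c) ⟩
  ∑[ c < v ] (𝟙 (toℕ c ≡ᵇ a) * g c) + ∑[ c < v ] (𝟙 (toℕ c ≡ᵇ b) * g c)
    ≡⟨ cong₂ _+_ (sum-𝟙-≡ᵇ g a<v) (sum-𝟙-≡ᵇ g b<v) ⟩
  g (fromℕ< a<v) + g (fromℕ< b<v)
    ∎
  where
  open ≡-Reasoning
  not-both : ∀ c → T (c ≡ᵇ a) → T (c ≡ᵇ b) → ⊥
  not-both c c≡a c≡b = a≢b (trans (sym (ℕ.≡ᵇ⇒≡ c a c≡a)) (ℕ.≡ᵇ⇒≡ c b c≡b))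

interSize-as-sum : ∀ {v p} q → IsPair v p →
  fromℕ (interSize p q) ≡ ∑[ c < v ] (𝟙 (toℕ c ∈ᵖ p) * 𝟙 (toℕ c ∈ᵖ q))
interSize-as-sum {v} {a , b} q (a<b , b<v) = sym (begin
  ∑[ c < v ] (𝟙 (toℕ c ∈ᵖ (a , b)) * 𝟙 (toℕ c ∈ᵖ q))
    ≡⟨ sum-𝟙-∈ᵖ (λ c → 𝟙 (toℕ c ∈ᵖ q)) (ℕ.<⇒≢ a<b) a<v b<v ⟩
  𝟙 (toℕ (fromℕ< a<v) ∈ᵖ q) + 𝟙 (toℕ (fromℕ< b<v) ∈ᵖ q)
    ≡⟨ cong₂ (λ a′ b′ → 𝟙 (a′ ∈ᵖ q) + 𝟙 (b′ ∈ᵖ q)) (toℕ-fromℕ< a<v) (toℕ-fromℕ< b<v) ⟩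
  𝟙 (a ∈ᵖ q) + 𝟙 (b ∈ᵖ q)
    ≡⟨ sym (fromℕ-+ (b2n (a ∈ᵖ q)) (b2n (b ∈ᵖ q))) ⟩
  fromℕ (interSize (a , b) q)
    ∎)
  where
  open ≡-Reasoning
  a<v : a < v
  a<v = ℕ.<-trans a<b b<v

sum-𝟙-∈ᵖ≡2 : ∀ {v p} → IsPair v p → ∑[ c < v ] (𝟙 (toℕ c ∈ᵖ p)) ≡ fromℕ 2
sum-𝟙-∈ᵖ≡2 {v} {a , b} (a<b , b<v) =
  trans (sum-cong-≗ {v} (λ c → sym (*-identityʳ (𝟙 (toℕ c ∈ᵖ (a , b))))))
        (sum-𝟙-∈ᵖ (λ _ → 1ℚ) (ℕ.<⇒≢ a<b) (ℕ.<-trans a<b b<v) b<v)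

b2n-T : ∀ {x} → T x → b2n x ≡ 1
b2n-T {true} _ = refl

b2n+b2n≡2 : ∀ x y → b2n x ℕ.+ b2n y ≡ 2 → T x × T y
b2n+b2n≡2 true  true  _ = _ , _
b2n+b2n≡2 true  false ()
b2n+b2n≡2 false true  ()
b2n+b2n≡2 false false ()

∈ᵖ⇒≡ : ∀ c a b → T (c ∈ᵖ (a , b)) → c ≡ a ⊎ c ≡ b
∈ᵖ⇒≡ c a b c∈ab with Equivalence.to T-∨ c∈ab
... | inj₁ c≡a = inj₁ (ℕ.≡ᵇ⇒≡ c a c≡a)
... | inj₂ c≡b = inj₂ (ℕ.≡ᵇ⇒≡ c b c≡b)

interSize-self : ∀ {v p} → IsPair v p → interSize p p ≡ 2
interSize-self {p = a , b} _ = cong₂ ℕ._+_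
  (b2n-T (Equivalence.from T-∨ (inj₁ (ℕ.≡⇒≡ᵇ a a refl))))
  (b2n-T (Equivalence.from T-∨ (inj₂ (ℕ.≡⇒≡ᵇ b b refl))))

interSize≡2⇒≡ : ∀ {v p q} → IsPair v p → IsPair v q → interSize p q ≡ 2 → p ≡ q
interSize≡2⇒≡ {p = a , b} {c , e} (a<b , _) (c<e , _) size≡2
  with b2n+b2n≡2 (a ∈ᵖ (c , e)) (b ∈ᵖ (c , e)) size≡2
... | a∈q , b∈q with ∈ᵖ⇒≡ a c e a∈q | ∈ᵖ⇒≡ b c e b∈q
... | inj₁ refl | inj₁ refl = ⊥-elim (ℕ.<-irrefl refl a<b)
... | inj₁ refl | inj₂ refl = refl
... | inj₂ refl | inj₁ refl = ⊥-elim (ℕ.<-asym a<b c<e)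
... | inj₂ refl | inj₂ refl = ⊥-elim (ℕ.<-irrefl refl a<b)

-- The enumeration of the pairs

tri : ℕ → ℕ
tri zero    = 0
tri (suc b) = tri b ℕ.+ b

-- The position of (a , b) in indexPairsM v, which lists the pairs column by column.
rank : ℕ × ℕ → ℕ
rank (a , b) = tri b ℕ.+ a

data RankedFrom (v : ℕ) : ℕ → List (ℕ × ℕ) → Set where
  []  : ∀ {n} → RankedFrom v n []
  _∷_ : ∀ {n p ps} → IsPair v p × rank p ≡ n → RankedFrom v (suc n) ps → RankedFrom v n (p ∷ ps)

++⁺ : ∀ {v n ps qs} → RankedFrom v n ps → RankedFrom v (n ℕ.+ length ps) qs → RankedFrom v n (ps ++ qs)
++⁺ {v} {n} {qs = qs} [] rqs = subst (λ m → RankedFrom v m qs) (ℕ.+-identityʳ n) rqs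
++⁺ {v} {n} {_ ∷ ps} {qs} (p ∷ rps) rqs =
  p ∷ ++⁺ rps (subst (λ m → RankedFrom v m qs) (ℕ.+-suc n (length ps)) rqs)

lookup⁺ : ∀ {v n ps} → RankedFrom v n ps → ∀ i →
          IsPair v (lookup ps i) × rank (lookup ps i) ≡ n ℕ.+ toℕ i
lookup⁺ {n = n} ((isPair , rank≡n) ∷ _) zero = isPair , trans rank≡n (sym (ℕ.+-identityʳ n))
lookup⁺ {n = n} (_ ∷ rps) (suc i) with lookup⁺ rps i
... | isPair , rank≡ = isPair , trans rank≡ (sym (ℕ.+-suc n (toℕ i)))

row : ℕ → ℕ → List (ℕ × ℕ)
row b a = map (λ a′ → (a′ , b)) (upTo a)

length-row : ∀ b a → length (row b a) ≡ a
length-row b a = trans (L.length-map (λ a′ → (a′ , b)) (upTo a)) (L.length-upTo a)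

row⁺ : ∀ {v b} a → a ≤ b → b < v → RankedFrom v (tri b) (row b a)
row⁺ zero _ _ = []
row⁺ {v} {b} (suc a) a<b b<v = subst (RankedFrom v (tri b)) row-snoc
  (++⁺ (row⁺ a (ℕ.<⇒≤ a<b) b<v) (((a<b , b<v) , cong (tri b ℕ.+_) (sym (length-row b a))) ∷ []))
  where
  row-snoc : row b a ++ (a , b) ∷ [] ≡ row b (suc a)
  row-snoc = trans (sym (L.map-++ (λ a′ → (a′ , b)) (upTo a) (a ∷ []))) (cong (map (λ a′ → (a′ , b))) (L.upTo-∷ʳ a))

rows : ℕ → List (ℕ × ℕ)
rows m = concatMap (λ b → row b b) (upTo m)

rows-suc : ∀ m → rows (suc m) ≡ rows m ++ row m m
rows-suc m = begin
  concatMap R (upTo (suc m))            ≡⟨ cong (concatMap R) (sym (L.upTo-∷ʳ m)) ⟩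
  concatMap R (upTo m ++ m ∷ [])        ≡⟨ L.concatMap-++ R (upTo m) (m ∷ []) ⟩
  rows m ++ (row m m ++ [])             ≡⟨ cong (rows m ++_) (L.++-identityʳ (row m m)) ⟩
  rows m ++ row m m                     ∎
  where
  open ≡-Reasoning
  R : ℕ → List (ℕ × ℕ)
  R b = row b b

length-rows : ∀ m → length (rows m) ≡ tri m
length-rows zero    = refl
length-rows (suc m) = begin
  length (rows (suc m))                 ≡⟨ cong length (rows-suc m) ⟩
  length (rows m ++ row m m)            ≡⟨ L.length-++ (rows m) ⟩
  length (rows m) ℕ.+ length (row m m)  ≡⟨ cong₂ ℕ._+_ (length-rows m) (length-row m m) ⟩
  tri m ℕ.+ m                           ∎
  where open ≡-Reasoning

rows⁺ : ∀ {v} m → m ≤ v → RankedFrom v 0 (rows m)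
rows⁺ zero    _   = []
rows⁺ {v} (suc m) m<v = subst (RankedFrom v 0) (sym (rows-suc m))
  (++⁺ (rows⁺ m (ℕ.<⇒≤ m<v)) (subst (λ n → RankedFrom v n (row m m)) (sym (length-rows m)) (row⁺ m ℕ.≤-refl m<v)))

indexPairs⁺ : ∀ v → RankedFrom v 0 (indexPairsM v)
indexPairs⁺ zero          = []
indexPairs⁺ (suc zero)    = []
indexPairs⁺ (suc (suc w)) = ++⁺ (rows⁺ (suc w) (ℕ.n≤1+n (suc w)))
  (subst (λ n → RankedFrom (suc (suc w)) n (row (suc w) w)) (sym (length-rows (suc w)))
         (row⁺ w (ℕ.n≤1+n w) ℕ.≤-refl))

idx-isPair : ∀ v i → IsPair v (idx v i)
idx-isPair v i = proj₁ (lookup⁺ (indexPairs⁺ v) i)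

idx-injective : ∀ v {i j} → idx v i ≡ idx v j → i ≡ j
idx-injective v {i} {j} idx≡ = toℕ-injective (begin
  toℕ i                 ≡⟨ sym (proj₂ (lookup⁺ (indexPairs⁺ v) i)) ⟩
  rank (idx v i)        ≡⟨ cong rank idx≡ ⟩
  rank (idx v j)        ≡⟨ proj₂ (lookup⁺ (indexPairs⁺ v) j) ⟩
  toℕ j                 ∎)
  where open ≡-Reasoning

2*tri+n≡n*n : ∀ n → 2 ℕ.* tri n ℕ.+ n ≡ n ℕ.* n
2*tri+n≡n*n zero    = refl
2*tri+n≡n*n (suc n) = begin
  2 ℕ.* (tri n ℕ.+ n) ℕ.+ suc n   ≡⟨ regroup (tri n) n ⟩
  (2 ℕ.* tri n ℕ.+ n) ℕ.+ (2 ℕ.* n ℕ.+ 1)  ≡⟨ cong (ℕ._+ (2 ℕ.* n ℕ.+ 1)) (2*tri+n≡n*n n) ⟩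
  n ℕ.* n ℕ.+ (2 ℕ.* n ℕ.+ 1)     ≡⟨ square n ⟩
  suc n ℕ.* suc n                 ∎
  where
  open ≡-Reasoning
  regroup : ∀ t n → 2 ℕ.* (t ℕ.+ n) ℕ.+ suc n ≡ (2 ℕ.* t ℕ.+ n) ℕ.+ (2 ℕ.* n ℕ.+ 1)
  regroup = ℕ-Solver.solve-∀
  square : ∀ n → n ℕ.* n ℕ.+ (2 ℕ.* n ℕ.+ 1) ≡ suc n ℕ.* suc n
  square = ℕ-Solver.solve-∀

dimM-formula : ∀ v → 2 ≤ v → 2 ℕ.* suc (dimM v) ≡ v ℕ.* (v ∸ 1)
dimM-formula (suc zero) (s≤s ())
dimM-formula (suc (suc w)) _ = begin
  2 ℕ.* suc (length (rows (suc w) ++ row (suc w) w))       ≡⟨ cong (λ n → 2 ℕ.* suc n) len ⟩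
  2 ℕ.* suc (tri (suc w) ℕ.+ w)                             ≡⟨ regroup (tri (suc w)) w ⟩
  (2 ℕ.* tri (suc w) ℕ.+ suc w) ℕ.+ suc w                   ≡⟨ cong (ℕ._+ suc w) (2*tri+n≡n*n (suc w)) ⟩
  suc w ℕ.* suc w ℕ.+ suc w                                 ≡⟨ factor w ⟩
  suc (suc w) ℕ.* suc w                                     ∎
  where
  open ≡-Reasoning
  len : length (rows (suc w) ++ row (suc w) w) ≡ tri (suc w) ℕ.+ w
  len = trans (L.length-++ (rows (suc w))) (cong₂ ℕ._+_ (length-rows (suc w)) (length-row (suc w) w))
  regroup : ∀ t w → 2 ℕ.* suc (t ℕ.+ w) ≡ (2 ℕ.* t ℕ.+ suc w) ℕ.+ suc w
  regroup = ℕ-Solver.solve-∀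
  factor : ∀ w → suc w ℕ.* suc w ℕ.+ suc w ≡ suc (suc w) ℕ.* suc w
  factor = ℕ-Solver.solve-∀

-- Positivity of the quadratic form of M

regroup-by-row-sum : ∀ V γ ρ θ t R S → V * (V - 1ℚ) * γ + fromℕ 2 * θ + fromℕ 4 * (V - 1ℚ) * ρ ≡ 0ℚ →
  V * (V - 1ℚ) * (γ * (t * t) + ρ * R + θ * S)
    ≡ θ * (V * (V - 1ℚ) * S - fromℕ 2 * (t * t)) + (V - 1ℚ) * ρ * (V * R - (fromℕ 2 * t) * (fromℕ 2 * t))
regroup-by-row-sum V γ ρ θ t R S rowSum≡0 = begin
  V * (V - 1ℚ) * (γ * (t * t) + ρ * R + θ * S)  ≡⟨ split V γ ρ θ t R S ⟩
  P + t * t * E                                 ≡⟨ cong (λ z → P + t * t * z) rowSum≡0 ⟩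
  P + t * t * 0ℚ                                ≡⟨ drop P (t * t) ⟩
  P                                             ∎
  where
  open ≡-Reasoning
  P E : ℚ
  P = θ * (V * (V - 1ℚ) * S - fromℕ 2 * (t * t)) + (V - 1ℚ) * ρ * (V * R - (fromℕ 2 * t) * (fromℕ 2 * t))
  E = V * (V - 1ℚ) * γ + fromℕ 2 * θ + fromℕ 4 * (V - 1ℚ) * ρ
  split : ∀ V γ ρ θ t R S → V * (V - 1ℚ) * (γ * (t * t) + ρ * R + θ * S)
    ≡ θ * (V * (V - 1ℚ) * S - fromℕ 2 * (t * t)) + (V - 1ℚ) * ρ * (V * R - (fromℕ 2 * t) * (fromℕ 2 * t))
      + t * t * (V * (V - 1ℚ) * γ + fromℕ 2 * θ + fromℕ 4 * (V - 1ℚ) * ρ)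
  split = solve-∀ ℚ-ring
  drop : ∀ p q → p + q * 0ℚ ≡ p
  drop = solve-∀ ℚ-ring

module PairCovariance (v k : ℕ) where

  open Coefficients v k

  incidence : Fin v → Fin (dimM v) → ℚ
  incidence c i = 𝟙 (toℕ c ∈ᵖ idx v i)

  M-entry : ∀ i j → M v k i j ≡ γ + ρ * ∑[ c < v ] (incidence c i * incidence c j) + θ * δ i j
  M-entry i j = trans (Nentry-shape (idx v i) (idx v j))
    (cong₂ (λ s b → γ + ρ * s + θ * 𝟙 b) (interSize-as-sum (idx v j) (idx-isPair v i))
           (does-⇔ (mk⇔ size≡2⇒i≡j i≡j⇒size≡2) (interSize (idx v i) (idx v j) ℕ.≟ 2) (toℕ i ℕ.≟ toℕ j)))
    where
    size≡2⇒i≡j : interSize (idx v i) (idx v j) ≡ 2 → toℕ i ≡ toℕ j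
    size≡2⇒i≡j size≡2 = cong toℕ (idx-injective v (interSize≡2⇒≡ (idx-isPair v i) (idx-isPair v j) size≡2))
    i≡j⇒size≡2 : toℕ i ≡ toℕ j → interSize (idx v i) (idx v j) ≡ 2
    i≡j⇒size≡2 i≡j rewrite toℕ-injective i≡j = interSize-self (idx-isPair v j)

  M-symmetric : ∀ i j → M v k i j ≡ M v k j i
  M-symmetric i j = begin
    M v k i j                                                              ≡⟨ M-entry i j ⟩
    γ + ρ * ∑[ c < v ] (incidence c i * incidence c j) + θ * δ i j
      ≡⟨ cong₂ (λ s d → γ + ρ * s + θ * d) (sum-cong-≗ (λ c → *-comm (incidence c i) (incidence c j))) (δ-sym i j) ⟩
    γ + ρ * ∑[ c < v ] (incidence c j * incidence c i) + θ * δ j i        ≡⟨ sym (M-entry j i) ⟩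
    M v k j i                                                              ∎
    where open ≡-Reasoning

  module _ (x : Fin (dimM v) → ℚ) where

    private
      n : ℕ
      n = dimM v

    degree : Fin v → ℚ
    degree c = ∑[ i < n ] (incidence c i * x i)

    quadForm-M : quadForm (M v k) x ≡ γ * (sum x * sum x) + ρ * sum-squares degree + θ * sum-squares x
    quadForm-M = begin
      quadForm (M v k) x
        ≡⟨ quadForm-cong x M-entry ⟩
      quadForm (λ i j → γ + ρ * G i j + θ * δ i j) x
        ≡⟨ quadForm-+ x (λ i j → γ + ρ * G i j) (λ i j → θ * δ i j) ⟩
      quadForm (λ i j → γ + ρ * G i j) x + quadForm (λ i j → θ * δ i j) x
        ≡⟨ cong₂ _+_ (quadForm-+ x (λ _ _ → γ) (λ i j → ρ * G i j)) (quadForm-* x θ δ) ⟩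
      quadForm (λ _ _ → γ) x + quadForm (λ i j → ρ * G i j) x + θ * quadForm δ x
        ≡⟨ cong₃ (λ a b c → a + b + θ * c) (quadForm-const x γ) (quadForm-* x ρ G) (quadForm-δ x) ⟩
      γ * (sum x * sum x) + ρ * quadForm G x + θ * sum-squares x
        ≡⟨ cong (λ g → γ * (sum x * sum x) + ρ * g + θ * sum-squares x) (quadForm-gram x incidence) ⟩
      γ * (sum x * sum x) + ρ * sum-squares degree + θ * sum-squares x
        ∎
      where
      open ≡-Reasoning
      G : Fin n → Fin n → ℚ
      G i j = ∑[ c < v ] (incidence c i * incidence c j)

    sum-degree : sum degree ≡ fromℕ 2 * sum x
    sum-degree = begin
      ∑[ c < v ] ∑[ i < n ] (incidence c i * x i)   ≡⟨ ∑-comm (λ c i → incidence c i * x i) ⟩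
      ∑[ i < n ] ∑[ c < v ] (incidence c i * x i)   ≡⟨ sum-cong-≗ (λ i → sym (*-distribʳ-sum (x i) (λ c → incidence c i))) ⟩
      ∑[ i < n ] (∑[ c < v ] incidence c i * x i)   ≡⟨ sum-cong-≗ (λ i → cong (_* x i) (sum-𝟙-∈ᵖ≡2 (idx-isPair v i))) ⟩
      ∑[ i < n ] (fromℕ 2 * x i)                    ≡⟨ sym (*-distribˡ-sum (fromℕ 2) x) ⟩
      fromℕ 2 * sum x                               ∎
      where open ≡-Reasoning

    module _ (2≤k : 2 ≤ k) (2≤v∸k : 2 ≤ v ∸ k) (i : Fin n) (xᵢ≢0 : x i ≢ 0ℚ) where

      private
        V N t : ℚ
        V = fromℕ v
        N = fromℕ n
        t = sum x

        2≤v : 2 ≤ v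
        2≤v = ℕ.≤-trans 2≤v∸k (ℕ.m∸n≤m v k)

        V-1≡ : V - 1ℚ ≡ fromℕ (v ∸ 1)
        V-1≡ = sym (fromℕ-∸ (ℕ.<⇒≤ 2≤v))

        V*[V-1]>0 : 0ℚ ℚ.< V * (V - 1ℚ)
        V*[V-1]>0 = subst (λ w → 0ℚ ℚ.< V * w) (sym V-1≡)
                          (*-pos (fromℕ-pos (ℕ.<-trans (s≤s z≤n) 2≤v)) (fromℕ-pos (ℕ.m<n⇒0<n∸m 2≤v)))

        V*[V-1]≡ : V * (V - 1ℚ) ≡ fromℕ 2 * (1ℚ + N)
        V*[V-1]≡ = begin
          V * (V - 1ℚ)               ≡⟨ cong (V *_) V-1≡ ⟩
          V * fromℕ (v ∸ 1)          ≡⟨ sym (fromℕ-* v (v ∸ 1)) ⟩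
          fromℕ (v ℕ.* (v ∸ 1))      ≡⟨ cong fromℕ (sym (dimM-formula v 2≤v)) ⟩
          fromℕ (2 ℕ.* suc n)        ≡⟨ fromℕ-* 2 (suc n) ⟩
          fromℕ 2 * fromℕ (suc n)    ≡⟨ cong (fromℕ 2 *_) (fromℕ-+ 1 n) ⟩
          fromℕ 2 * (1ℚ + N)         ∎
          where open ≡-Reasoning

        -- This is where deleting a row matters: V (V - 1) = 2 (n + 1) exceeds 2 n.
        spread>0 : 0ℚ ℚ.< V * (V - 1ℚ) * sum-squares x - fromℕ 2 * (t * t)
        spread>0 = subst (0ℚ ℚ.<_) (sym (trans (cong (λ w → w * sum-squares x - fromℕ 2 * (t * t)) V*[V-1]≡)
                                            (factor N (sum-squares x) t)))
          (*-pos (fromℕ-pos (s≤s z≤n)) (+-pos-nonNeg (sum-squares-pos x i xᵢ≢0) (cauchy-schwarz x)))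
          where
          factor : ∀ N S t → fromℕ 2 * (1ℚ + N) * S - fromℕ 2 * (t * t) ≡ fromℕ 2 * (S + (N * S - t * t))
          factor = solve-∀ ℚ-ring

        degree-spread≥0 : 0ℚ ℚ.≤ V * sum-squares degree - (fromℕ 2 * t) * (fromℕ 2 * t)
        degree-spread≥0 = subst (λ s → 0ℚ ℚ.≤ V * sum-squares degree - s * s) sum-degree (cauchy-schwarz degree)

        V-1≥0 : 0ℚ ℚ.≤ V - 1ℚ
        V-1≥0 = subst (0ℚ ℚ.≤_) (sym V-1≡) (fromℕ-nonNeg (v ∸ 1))

        regrouped : V * (V - 1ℚ) * quadForm (M v k) x
                  ≡ θ * (V * (V - 1ℚ) * sum-squares x - fromℕ 2 * (t * t))
                    + (V - 1ℚ) * ρ * (V * sum-squares degree - (fromℕ 2 * t) * (fromℕ 2 * t))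
        regrouped = trans (cong (V * (V - 1ℚ) *_) quadForm-M)
                          (regroup-by-row-sum V γ ρ θ t (sum-squares degree) (sum-squares x) (rowSum≡0 2≤k 2≤v∸k))

      quadForm-M-pos : 0ℚ ℚ.< quadForm (M v k) x
      quadForm-M-pos = 0<d*p⇒0<p V*[V-1]>0 (subst (0ℚ ℚ.<_) (sym regrouped)
        (+-pos-nonNeg (*-pos (θ>0 2≤k 2≤v∸k) spread>0) (*-nonNeg (*-nonNeg V-1≥0 (ρ≥0 2≤k 2≤v∸k)) degree-spread≥0)))

corollary6p3 : (v k : ℕ) → 2 ≤ k → 2 ≤ v ∸ k → IsPositiveDefinite (dimM v) (M v k)
corollary6p3 v k 2≤k 2≤v∸k = M-symmetric , λ x (i , xᵢ≢0) →
  subst (0ℚ ℚ.<_) (sym (Σ≡quadForm x (M v k))) (quadForm-M-pos x 2≤k 2≤v∸k i xᵢ≢0)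
  where open PairCovariance v k
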